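{- Let $\langle E_1,\ldots,E_n,op_1,\ldots,op_p\rangle$ be a structure with stable computability. Then, for all families of sets $F_1,\ldots,F_{m+1}$ and all indexings $i_1,\ldots,i_{m+1}$ and $i'_1,\ldots,i'_{m+1}$ of this family such that for all $k$ either $i_k=i'_k$, or $F_k$ is some $E_l$ and $i_k$ and $i'_k$ are two indexings of $E_l$ extracted from two admissible indexings of the structure $\langle E_1,\ldots,E_n,op_1,\ldots,op_p\rangle$ (that is, $i_k$ and $i'_k$ are the $l$-th components of two such admissible indexings), the set of functions from $F_1\times\ldots\times F_m$ to $F_{m+1}$ that are computable relatively to $i_1,\ldots,i_{m+1}$ is the same as the set of those computable relatively to $i'_1,\ldots,i'_{m+1}$.
   Context: Computability over natural numbers is the usual one. A set $A \subseteq \mathbb{N}$ is effectively enumerable if it is empty or the image of a total computable function from $\mathbb{N}$ to $\mathbb{N}$. For $A \subseteq \mathbb{N}^m$ and $B \subseteq \mathbb{N}$, a computable function from $A$ to $B$ is a partial computable function that is defined at every element of $A$ and takes values in $B$ there. Indexing: an indexing of a set $E$ is a partial function $i$ from $\mathbb{N}$ to $E$ such that $dom(i)$ is effectively enumerable, $i$ is surjective, and there is a computable function $eq$ from $dom(i)\times dom(i)$ to $\{0,1\}$ with $eq(x,y)=1$ if $i(x)=i(y)$ and $eq(x,y)=0$ otherwise. An indexing of a family of sets $E_1,\ldots,E_n$ is a family $i_1,\ldots,i_n$ of indexings of $E_1,\ldots,E_n$. Computable function: given sets $E_1,\ldots,E_m,E_{m+1}$ with indexings $i_1,\ldots,i_{m+1}$,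 a function $f: E_1\times\ldots\times E_m \to E_{m+1}$ is computable relatively to this indexing if there is a computable function $\hat f$ from $dom(i_1)\times\ldots\times dom(i_m)$ to $dom(i_{m+1})$ such that $i_{m+1}(\hat f(x_1,\ldots,x_m)) = f(i_1(x_1),\ldots,i_m(x_m))$ for all $x_k \in dom(i_k)$. Admissible indexing: a structure $\langle E_1,\ldots,E_n,op_1,\ldots,op_p\rangle$ consists of sets $E_1,\ldots,E_n$ and operations, each from a product of some of these sets to one of these sets. An indexing of it is an indexing of $E_1,\ldots,E_n$; it is admissible if every $op_k$ is computable relatively to the indexings of its domains and co-domain. Stable computability: computability is stable over $\langle E_1,\ldots,E_n,op_1,\ldots,op_p\rangle$ if there exists an admissible indexing of this structure and, for all admissible indexings $j_1,\ldots,j_n$ and $j'_1,\ldots,j'_n$ of it, there exist computable functions $h_k$ from $dom(j'_k)$ to $dom(j_k)$ such that $j'_k = j_k\circ h_k$, for $k=1,\ldots,n$. -}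

module Defs where

open import Data.Fin using (Fin; zero; suc; inject₁; fromℕ)
open import Data.Nat using (ℕ; zero; suc; _<_)
open import Data.Product using (Σ; ∃; _×_; _,_)
open import Data.Sum using (_⊎_)
open import Data.Unit.Polymorphic using (⊤)
open import Data.Vec using (Vec; []; _∷_; lookup)
open import Function using (_∘_)
open import Level using (Level; _⊔_) renaming (suc to lsuc)
open import Relation.Binary.Core using (REL; _⇔_)
open import Relation.Binary.PropositionalEquality using (_≡_; _≢_)
open import Relation.Unary using (Pred; _∈_; _≐_; Empty; U)

private
  variable
    a b ℓ : Level

-- Codes of k-ary partial recursive functions.
data Code : ℕ → Set where
  zer  : Code 0
  succ : Code 1
  proj : ∀ {k} → Fin k → Code k
  comp : ∀ {k l} → Code l → Vec (Code k) l → Code k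
  prec : ∀ {k} → Code k → Code (suc (suc k)) → Code (suc k)
  mu   : ∀ {k} → Code (suc k) → Code k

infix 4 _[_]⇓_

-- c [ xs ]⇓ y : the partial function coded by c is defined at xs, with value y.
data _[_]⇓_ : ∀ {k} → Code k → Vec ℕ k → ℕ → Set where
  zer⇓   : zer [ [] ]⇓ 0
  succ⇓  : ∀ {x} → succ [ x ∷ [] ]⇓ suc x
  proj⇓  : ∀ {k} {xs : Vec ℕ k} (p : Fin k) → proj p [ xs ]⇓ lookup xs p
  comp⇓  : ∀ {k l} {c : Code l} {ds : Vec (Code k) l} {xs ys z} →
           (∀ p → lookup ds p [ xs ]⇓ lookup ys p) → c [ ys ]⇓ z →
           comp c ds [ xs ]⇓ z
  prec-z : ∀ {k} {c : Code k} {d xs y} →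
           c [ xs ]⇓ y → prec c d [ 0 ∷ xs ]⇓ y
  prec-s : ∀ {k} {c : Code k} {d x xs y z} →
           prec c d [ x ∷ xs ]⇓ y → d [ x ∷ y ∷ xs ]⇓ z →
           prec c d [ suc x ∷ xs ]⇓ z
  mu⇓    : ∀ {k} {c : Code (suc k)} {xs y} →
           c [ y ∷ xs ]⇓ 0 → (∀ x → x < y → ∃ λ z → c [ x ∷ xs ]⇓ suc z) →
           mu c [ xs ]⇓ y

-- Nothing is required of the code outside A.
record ComputableFunction {k} (A : Pred (Vec ℕ k) a) (B : Pred ℕ b) : Set (a ⊔ b) where
  field
    code    : Code k
    defined : ∀ {xs} → xs ∈ A → ∃ λ y → code [ xs ]⇓ y × y ∈ B

open ComputableFunction public

∏ : ∀ {k} → (Fin k → Pred ℕ ℓ) → Pred (Vec ℕ k) ℓ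
∏ A xs = ∀ p → lookup xs p ∈ A p

EffectivelyEnumerable : Pred ℕ ℓ → Set ℓ
EffectivelyEnumerable A =
  Empty A ⊎
  Σ (ComputableFunction {k = 1} U U) λ g → A ≐ λ y → ∃ λ x → code g [ x ∷ [] ]⇓ y

-- A partial function is given by its graph.
record Indexing (E : Set a) : Set (lsuc a) where
  field
    graph      : REL ℕ E a
    functional : ∀ {x e e′} → graph x e → graph x e′ → e ≡ e′

  dom : Pred ℕ a
  dom x = ∃ λ e → graph x e

  field
    dom-enumerable : EffectivelyEnumerable dom
    surjective     : ∀ e → ∃ λ x → graph x e
    eq             : ComputableFunction {k = 2} (∏ λ _ → dom) (λ v → v ≡ 0 ⊎ v ≡ 1)
    eq-1           : ∀ {x y e e′} → graph x e → graph y e′ →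
                     e ≡ e′ → code eq [ x ∷ y ∷ [] ]⇓ 1
    eq-0           : ∀ {x y e e′} → graph x e → graph y e′ →
                     e ≢ e′ → code eq [ x ∷ y ∷ [] ]⇓ 0

open Indexing public

infix 4 _≈_

-- Equality of indexings as partial functions, whatever the witnesses they carry.
_≈_ : {E : Set a} → Indexing E → Indexing E → Set a
i ≈ j = graph i ⇔ graph j

Tuple : ∀ {m} → (Fin m → Set a) → Set a
Tuple {m = zero}  F = ⊤
Tuple {m = suc m} F = F zero × Tuple (F ∘ suc)

component : ∀ {m} (F : Fin m → Set a) → Tuple F → ∀ k → F k
component F (e , es) zero    = e
component F (e , es) (suc k) = component (F ∘ suc) es k

-- The last set of a family F₁, …, Fₘ₊₁ is the co-domain.
Function : ∀ {m} → (Fin (suc m) → Set a) → Set a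
Function {m = m} F = Tuple (F ∘ inject₁) → F (fromℕ m)

record Computable {m} {F : Fin (suc m) → Set a} (i : ∀ k → Indexing (F k))
                  (f : Function F) : Set a where
  field
    f̂        : ComputableFunction (∏ λ k → dom (i (inject₁ k))) (dom (i (fromℕ m)))
    commutes : ∀ {xs y} (es : Tuple (F ∘ inject₁)) →
               (∀ k → graph (i (inject₁ k)) (lookup xs k) (component (F ∘ inject₁) es k)) →
               code f̂ [ xs ]⇓ y → graph (i (fromℕ m)) y (f es)

-- The operation q goes from E (sort q 0) × … to E (sort q (arity q)).
record Structure a : Set (lsuc a) where
  field
    n     : ℕ
    E     : Fin n → Set a
    p     : ℕ
    arity : Fin p → ℕ
    sort  : ∀ q → Fin (suc (arity q)) → Fin n
    op    : ∀ q → Function (E ∘ sort q)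

module _ (S : Structure a) where
  open Structure S

  StructureIndexing : Set (lsuc a)
  StructureIndexing = ∀ l → Indexing (E l)

  Admissible : StructureIndexing → Set a
  Admissible j = ∀ q → Computable (j ∘ sort q) (op q)

  record Stable : Set (lsuc a) where
    field
      admissible : ∃ λ j → Admissible j
      translate  : ∀ j j′ → Admissible j → Admissible j′ → ∀ l →
                   Σ (ComputableFunction {k = 1} (∏ λ _ → dom (j′ l)) (dom (j l))) λ h →
                   -- j′ₗ = jₗ ∘ h, where h has domain dom j′ₗ
                   graph (j′ l) ⇔ λ x e →
                     x ∈ dom (j′ l) × ∃ λ y → code h [ x ∷ [] ]⇓ y × graph (j l) y e

  -- The index E l of the result expresses that F is one of the sets of S.
  data Extracted : {F : Set a} → Indexing F → Indexing F → Set (lsuc a) where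
    extracted : ∀ j j′ → Admissible j → Admissible j′ →
                ∀ l {i i′ : Indexing (E l)} → i ≈ j l → i′ ≈ j′ l → Extracted i i′

{-# OPTIONS --safe #-}

-- Translating the arguments from i′ to i, applying a code computing f relatively to i and
-- translating the result back from i to i′ gives a code computing f relatively to i′.
-- Stability provides the translations, in both directions, for extracted indexings.
module Submission where

open import Defs
open import Data.Fin using (Fin; zero; suc; inject₁; fromℕ)
open import Data.Nat using (ℕ; suc)
open import Data.Nat.Properties using (<-cmp)
open import Data.Product using (Σ; ∃; _×_; _,_; proj₁; proj₂; swap)
open import Data.Sum using (_⊎_; inj₁; inj₂; map)
open import Data.Unit.Polymorphic using (tt)
open import Data.Vec using (Vec; []; _∷_; lookup; tabulate)
open import Data.Vec.Properties using (lookup∘tabulate)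
open import Data.Vec.Relation.Binary.Pointwise.Extensional using (ext; Pointwise-≡⇒≡)
open import Function using (_⇔_; mk⇔; _∘_)
open import Relation.Binary.Definitions using (tri<; tri≈; tri>)
open import Relation.Binary.PropositionalEquality using (_≡_; refl; sym; subst; subst₂)
open import Relation.Nullary using (contradiction)

⇓-deterministic : ∀ {k} {c : Code k} {xs y z} → c [ xs ]⇓ y → c [ xs ]⇓ z → y ≡ z
⇓-deterministic zer⇓ zer⇓ = refl
⇓-deterministic succ⇓ succ⇓ = refl
⇓-deterministic (proj⇓ _) (proj⇓ _) = refl
⇓-deterministic (comp⇓ {ys = ys} ds c) (comp⇓ {ys = zs} ds′ c′)
  with refl ← Pointwise-≡⇒≡ {xs = ys} {ys = zs} (ext λ p → ⇓-deterministic (ds p) (ds′ p)) =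
  ⇓-deterministic c c′
⇓-deterministic (prec-z c) (prec-z c′) = ⇓-deterministic c c′
⇓-deterministic (prec-s c d) (prec-s c′ d′)
  with refl ← ⇓-deterministic c c′ = ⇓-deterministic d d′
⇓-deterministic {y = y} {z} (mu⇓ c below) (mu⇓ c′ below′) with <-cmp y z
... | tri≈ _ y≡z _ = y≡z
... | tri< y<z _ _ = contradiction (⇓-deterministic c (proj₂ (below′ y y<z))) λ ()
... | tri> _ _ z<y = contradiction (⇓-deterministic (proj₂ (below z z<y)) c′) λ ()

tuple : ∀ {a m} (F : Fin m → Set a) → (∀ k → F k) → Tuple F
tuple {m = 0}     F e = tt
tuple {m = suc m} F e = e zero , tuple (F ∘ suc) (e ∘ suc)

component-tuple : ∀ {a m} (F : Fin m → Set a) (e : ∀ k → F k) k →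
                  component F (tuple F e) k ≡ e k
component-tuple F e zero    = refl
component-tuple F e (suc k) = component-tuple (F ∘ suc) (e ∘ suc) k

Translation : ∀ {a} {E : Set a} → Indexing E → Indexing E → Set a
Translation i i′ = Σ (Code 1) λ h → ∀ {x e} → graph i x e →
                   ∃ λ y → h [ x ∷ [] ]⇓ y × graph i′ y e

≈⇒translation : ∀ {a} {E : Set a} {i i′ : Indexing E} → i ≈ i′ → Translation i i′
≈⇒translation (i⇒i′ , _) = proj zero , λ g → _ , proj⇓ zero , i⇒i′ g

extracted⇒translation : ∀ {a} {S : Structure a} → Stable S →
                        ∀ {E : Set a} {i i′ : Indexing E} → Extracted S i i′ → Translation i i′
extracted⇒translation stable (extracted j j′ adm adm′ l (i⇒j , _) (_ , j′⇒i′))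
  with h , (j⇒j′∘h , _) ← Stable.translate stable j′ j adm′ adm l =
  code h , λ g → let _ , y , h⇓y , g′ = j⇒j′∘h (i⇒j g) in y , h⇓y , j′⇒i′ g′

extracted-sym : ∀ {a} {S : Structure a} {E : Set a} {i i′ : Indexing E} →
                Extracted S i i′ → Extracted S i′ i
extracted-sym (extracted j j′ adm adm′ l i≈j i′≈j′) = extracted j′ j adm′ adm l i′≈j′ i≈j

module _ {a m} {F : Fin (suc m) → Set a} (f : Function F) where

  Args : Set a
  Args = Tuple (F ∘ inject₁)

  Represents : (∀ k → Indexing (F k)) → Vec ℕ m → Args → Set a
  Represents i xs es =
    ∀ k → graph (i (inject₁ k)) (lookup xs k) (component (F ∘ inject₁) es k)

  Computes : (∀ k → Indexing (F k)) → Code m → Set a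
  Computes i c = ∀ {xs es} → Represents i xs es →
                 ∃ λ y → c [ xs ]⇓ y × graph (i (fromℕ m)) y (f es)

  computable⇒computes : ∀ {i} (cf : Computable i f) → Computes i (code (Computable.f̂ cf))
  computable⇒computes cf {es = es} r
    with y , c⇓y , _ ← defined (Computable.f̂ cf) (λ k → _ , r k) =
    y , c⇓y , Computable.commutes cf es r c⇓y

  computes⇒computable : ∀ {i} (c : Code m) → Computes i c → Computable i f
  computes⇒computable {i} c computes = record
    { f̂ = record
      { code    = c
      ; defined = λ {xs} xs∈ →
          let es = tuple (F ∘ inject₁) (proj₁ ∘ xs∈)
              y , c⇓y , g = computes {xs} {es} λ k →
                subst (graph (i (inject₁ k)) (lookup xs k))
                      (sym (component-tuple (F ∘ inject₁) (proj₁ ∘ xs∈) k)) (proj₂ (xs∈ k))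
          in y , c⇓y , f es , g
      }
    ; commutes = λ {xs} es r c⇓y →
        let _ , c⇓z , g = computes {xs} {es} r
        in subst (λ z → graph (i (fromℕ m)) z (f es)) (⇓-deterministic c⇓z c⇓y) g
    }

  computable-translate : ∀ {i i′} → (∀ k → Translation (i k) (i′ k)) →
                         (∀ k → Translation (i′ k) (i k)) → Computable i f → Computable i′ f
  computable-translate {i} {i′} to from c = computes⇒computable conjugate computes
    where
    argument : Fin m → Code m
    argument k = comp (proj₁ (from (inject₁ k))) (proj k ∷ [])

    conjugate : Code m
    conjugate = comp (proj₁ (to (fromℕ m)))
                     (comp (code (Computable.f̂ c)) (tabulate argument) ∷ [])

    computes : Computes i′ conjugate
    computes {xs} {es} r =
      let translated k = proj₂ (from (inject₁ k)) (r k)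
          value k = proj₁ (translated k)
          ys = tabulate value
          arguments⇓ k = subst₂ (λ d y → d [ xs ]⇓ y)
            (sym (lookup∘tabulate argument k)) (sym (lookup∘tabulate value k))
            (comp⇓ {ys = lookup xs k ∷ []} (λ { zero → proj⇓ k }) (proj₁ (proj₂ (translated k))))
          y , f̂⇓y , g = computable⇒computes c {ys} {es} λ k →
            subst (λ y → graph (i (inject₁ k)) y (component (F ∘ inject₁) es k))
                  (sym (lookup∘tabulate value k)) (proj₂ (proj₂ (translated k)))
          z , h⇓z , g′ = proj₂ (to (fromℕ m)) g
      in z , comp⇓ {ys = y ∷ []} (λ { zero → comp⇓ {ys = ys} arguments⇓ f̂⇓y }) h⇓z , g′

proposition2 : ∀ {a} (S : Structure a) → Stable S →
    ∀ (m : ℕ) (F : Fin (suc m) → Set a) (i i′ : ∀ k → Indexing (F k)) →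
    (∀ k → i k ≈ i′ k ⊎ Extracted S (i k) (i′ k)) →
    ∀ (f : Function F) → Computable i f ⇔ Computable i′ f
proposition2 S stable m F i i′ related f =
  mk⇔ (computable-translate f to from) (computable-translate f from to)
  where
  translation : ∀ {E} {j j′ : Indexing E} → j ≈ j′ ⊎ Extracted S j j′ → Translation j j′
  translation {j = j} {j′} (inj₁ j≈j′) = ≈⇒translation {i = j} {j′} j≈j′
  translation (inj₂ ex)   = extracted⇒translation stable ex

  to : ∀ k → Translation (i k) (i′ k)
  to k = translation (related k)

  from : ∀ k → Translation (i′ k) (i k)
  from k = translation (map swap extracted-sym (related k))
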